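{- For every integer $k$ and every $k$-tree $G$, we have $\mathrm{dim}_{cb}(G)\le \mathrm{dim}^{ext}_{cb}(G)\le k+1$.
   Context: A box is an axis-aligned box in $\mathbb{R}^d$ (Cartesian product of closed intervals of non-zero length); $B[i]$ denotes the projection of a box $B$ to the $i$-th coordinate. $B_1\sqsubseteq B_2$ means $B_2$ contains a translate of $B_1$; boxes are comparable if one is $\sqsubseteq$ the other. A touching representation of $G$ by boxes is a map $h$ from $V(G)$ to boxes such that distinct vertices get boxes with disjoint interiors, and $h(u)\cap h(v)\ne\emptyset$ iff $uv\in E(G)$; it is by comparable boxes if all pairs of boxes are comparable. $\mathrm{dim}_{cb}(G)$ is the least $d$ such that $G$ has a touching representation by comparable boxes in $\mathbb{R}^d$. Clique-sum extendability: let $G$ have a distinguished clique $C^\star$ (possibly empty, denoted $\emptyset$). A touching representation $h$ of $G$ by boxes in $\mathbb{R}^d$ is $C^\star$-clique-sum extendable if, for every sufficiently small $\varepsilon>0$: (vertices) for each $u\in V(C^\star)$ there is a dimension $d_u$ with (v0) $d_u\neq d_{u'}$ for distinct $u,u'\in V(C^\star)$, (v1) $h(u)[d_u]=[-1,0]$ and $h(u)[i]=[0,1]$ for all $i\neq d_u$, and (v2) every $v\notin V(C^\star)$ satisfies $h(v)\subset[0,1)^d$; (cliques) for every clique $C$ of $G$ there is a point $p(C)\in[0,1)^d\cap\bigcap_{v\in V(C)}h(v)$ such that, defining the box $h^\varepsilon(C)$ by $h^\varepsilon(C)[i]=[p(C)[i],p(C)[i]+\varepsilon]$ for all $i$: (c1)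 $h^\varepsilon(C_1)\cap h^\varepsilon(C_2)=\emptyset$ for distinct cliques $C_1,C_2$; (c2) $h(v)$ intersects $h^\varepsilon(C)$ iff $v\in V(C)$, and in that case there is a dimension $i_{C,v}$ such that $h(v)[j]\cap h^\varepsilon(C)[j]=\{p(C)[i_{C,v}]\}$ if $j=i_{C,v}$ and $=[p(C)[j],p(C)[j]+\varepsilon]$ otherwise. $\mathrm{dim}^{ext}_{cb}(G)$ is the least $d$ such that $G$ has an $\emptyset$-clique-sum extendable touching representation by comparable boxes in $\mathbb{R}^d$. A full clique-sum of graphs $G_1,G_2$ is obtained from their disjoint union by identifying the vertices of a clique in $G_1$ with those of a clique of the same size in $G_2$ (keeping all edges). A $k$-tree is any graph obtained by repeated full clique-sums on cliques of size $k$ from cliques of size at most $k+1$. -}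

module Defs where

open import Data.Nat using (ℕ; suc; _≤_)
open import Data.Fin using (Fin)
open import Data.Fin.Subset using (Subset; _∈_)
open import Data.Product using (Σ; Σ-syntax; ∃; ∃-syntax; _×_; _,_)
open import Data.Sum using (_⊎_)
open import Relation.Nullary using (¬_)
open import Relation.Binary.PropositionalEquality using (_≡_; _≢_; subst₂)

-- The real numbers, given axiomatically as a (Dedekind-)complete
-- ordered field.  Every model is isomorphic to ℝ, so quantifying over
-- all models is the same as stating the result for ℝ.

record RealField : Set₁ where
  infixl 6 _+_
  infixl 7 _*_
  infix 4 _<_ _≤ᵣ_
  field
    Carrier : Set
    0ᵣ 1ᵣ   : Carrier
    _+_ _*_ : Carrier → Carrier → Carrier
    -_      : Carrier → Carrier
    _<_     : Carrier → Carrier → Set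

  _≤ᵣ_ : Carrier → Carrier → Set
  x ≤ᵣ y = (x < y) ⊎ (x ≡ y)

  field
    +-assoc    : ∀ x y z → (x + y) + z ≡ x + (y + z)
    +-comm     : ∀ x y → x + y ≡ y + x
    +-identity : ∀ x → 0ᵣ + x ≡ x
    +-inverse  : ∀ x → x + (- x) ≡ 0ᵣ
    *-assoc    : ∀ x y z → (x * y) * z ≡ x * (y * z)
    *-comm     : ∀ x y → x * y ≡ y * x
    *-identity : ∀ x → 1ᵣ * x ≡ x
    distrib    : ∀ x y z → x * (y + z) ≡ (x * y) + (x * z)
    0≢1        : 0ᵣ ≢ 1ᵣ
    *-inverse  : ∀ x → x ≢ 0ᵣ → ∃[ y ] (x * y ≡ 1ᵣ)
    <-irrefl   : ∀ x → ¬ (x < x)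
    <-trans    : ∀ {x y z} → x < y → y < z → x < z
    trichotomy : ∀ x y → (x < y) ⊎ (x ≡ y) ⊎ (y < x)
    +-mono-<   : ∀ {x y} z → x < y → x + z < y + z
    *-pos      : ∀ {x y} → 0ᵣ < x → 0ᵣ < y → 0ᵣ < x * y
    complete   : (P : Carrier → Set) → ∃ P → (∃[ u ] (∀ x → P x → x ≤ᵣ u)) →
                 ∃[ s ] ((∀ x → P x → x ≤ᵣ s) ×
                         (∀ u → (∀ x → P x → x ≤ᵣ u) → s ≤ᵣ u))

record Graph : Set₁ where
  field
    n      : ℕ
    Adj    : Fin n → Fin n → Set
    sym    : ∀ {u v} → Adj u v → Adj v u
    irrefl : ∀ {u} → ¬ Adj u u

open Graph public

-- a clique of G given as a vertex subset (includes ∅ and singletons)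
IsClique : (G : Graph) → Subset (n G) → Set
IsClique G C = ∀ u v → u ∈ C → v ∈ C → u ≢ v → Adj G u v

record KClique (G : Graph) (k : ℕ) : Set where
  field
    vert  : Fin k → Fin (n G)
    inj   : ∀ i j → vert i ≡ vert j → i ≡ j
    adj   : ∀ i j → i ≢ j → Adj G (vert i) (vert j)
open KClique public

IsCompleteAtMost : ℕ → Graph → Set
IsCompleteAtMost m G = (n G ≤ m) × (∀ u v → (Adj G u v → u ≢ v) × (u ≢ v → Adj G u v))

record IsFullCliqueSum (k : ℕ) (G G₁ G₂ : Graph) : Set where
  field
    C₁ : KClique G₁ k
    C₂ : KClique G₂ k
    f₁ : Fin (n G₁) → Fin (n G)
    f₂ : Fin (n G₂) → Fin (n G)
    f₁-inj : ∀ x y → f₁ x ≡ f₁ y → x ≡ y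
    f₂-inj : ∀ x y → f₂ x ≡ f₂ y → x ≡ y
    glue   : ∀ i → f₁ (vert C₁ i) ≡ f₂ (vert C₂ i)
    meetOnly : ∀ x y → f₁ x ≡ f₂ y → ∃[ i ] ((x ≡ vert C₁ i) × (y ≡ vert C₂ i))
    cover  : ∀ u → (∃[ x ] (f₁ x ≡ u)) ⊎ (∃[ y ] (f₂ y ≡ u))
    adj₁   : ∀ x y → (Adj G₁ x y → Adj G (f₁ x) (f₁ y)) × (Adj G (f₁ x) (f₁ y) → Adj G₁ x y)
    adj₂   : ∀ x y → (Adj G₂ x y → Adj G (f₂ x) (f₂ y)) × (Adj G (f₂ x) (f₂ y) → Adj G₂ x y)
    edges  : ∀ u v → Adj G u v →
             (∃[ x ] ∃[ y ] ((f₁ x ≡ u) × (f₁ y ≡ v))) ⊎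
             (∃[ x ] ∃[ y ] ((f₂ x ≡ u) × (f₂ y ≡ v)))

data IsKTree (k : ℕ) : Graph → Set₁ where
  base : ∀ {G} → IsCompleteAtMost (suc k) G → IsKTree k G
  csum : ∀ {G G₁ G₂} → IsKTree k G₁ → IsKTree k G₂ →
         IsFullCliqueSum k G G₁ G₂ → IsKTree k G

module Geom (R : RealField) where
  open RealField R

  Point : ℕ → Set
  Point d = Fin d → Carrier

  record Box (d : ℕ) : Set where
    field
      lo hi : Fin d → Carrier
      lo<hi : ∀ i → lo i < hi i
  open Box public

  _∈B_ : ∀ {d} → Point d → Box d → Set
  x ∈B B = ∀ i → (lo B i ≤ᵣ x i) × (x i ≤ᵣ hi B i)

  _∈int_ : ∀ {d} → Point d → Box d → Set
  x ∈int B = ∀ i → (lo B i < x i) × (x i < hi B i)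

  Meet : ∀ {d} → Box d → Box d → Set
  Meet B₁ B₂ = ∃[ x ] ((x ∈B B₁) × (x ∈B B₂))

  InteriorsDisjoint : ∀ {d} → Box d → Box d → Set
  InteriorsDisjoint B₁ B₂ = ¬ (∃[ x ] ((x ∈int B₁) × (x ∈int B₂)))

  _⊑_ : ∀ {d} → Box d → Box d → Set
  B₁ ⊑ B₂ = Σ[ t ∈ Point _ ] (∀ i → (lo B₂ i ≤ᵣ lo B₁ i + t i) × (hi B₁ i + t i ≤ᵣ hi B₂ i))

  Comparable : ∀ {d} → Box d → Box d → Set
  Comparable B₁ B₂ = (B₁ ⊑ B₂) ⊎ (B₂ ⊑ B₁)

  record TouchingCB (G : Graph) (d : ℕ) : Set where
    field
      h        : Fin (n G) → Box d
      disjoint : ∀ u v → u ≢ v → InteriorsDisjoint (h u) (h v)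
      touch    : ∀ u v → u ≢ v → (Meet (h u) (h v) → Adj G u v) × (Adj G u v → Meet (h u) (h v))
      comp     : ∀ u v → Comparable (h u) (h v)
  open TouchingCB public

  InUnitCube : ∀ {d} → Point d → Set
  InUnitCube x = ∀ i → (0ᵣ ≤ᵣ x i) × (x i < 1ᵣ)

  cube : ∀ {d} → Point d → (ε : Carrier) → 0ᵣ < ε → Box d
  cube p ε ε>0 = record { lo = p ; hi = λ i → p i + ε ; lo<hi = lemma }
    where
      lemma : ∀ i → p i < p i + ε
      lemma i = subst₂ _<_ (+-identity (p i)) (+-comm ε (p i)) (+-mono-< (p i) ε>0)

  -- ∅-clique-sum extendability ((v0),(v1) are vacuous for C⋆ = ∅)
  Extendable : (G : Graph) (d : ℕ) → TouchingCB G d → Set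
  Extendable G d T =
    (∀ v → (∀ i → (0ᵣ ≤ᵣ lo (h T v) i) × (hi (h T v) i < 1ᵣ))) ×
    Σ[ ε₀ ∈ Carrier ] ((0ᵣ < ε₀) × (∀ ε → (ε>0 : 0ᵣ < ε) → ε < ε₀ →
      Σ[ p ∈ (Subset (n G) → Point d) ] (
        (∀ C → IsClique G C → InUnitCube (p C) × (∀ v → v ∈ C → p C ∈B h T v)) ×
        (∀ C₁ C₂ → IsClique G C₁ → IsClique G C₂ → C₁ ≢ C₂ →
           ¬ Meet (cube (p C₁) ε ε>0) (cube (p C₂) ε ε>0)) ×
        (∀ C → IsClique G C → ∀ v →
           ((Meet (h T v) (cube (p C) ε ε>0) → v ∈ C) ×
            (v ∈ C → Meet (h T v) (cube (p C) ε ε>0))) ×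
           (v ∈ C → ∃[ i ] (∀ j → ∀ x →
              let inter = (lo (h T v) j ≤ᵣ x) × (x ≤ᵣ hi (h T v) j) ×
                          (p C j ≤ᵣ x) × (x ≤ᵣ p C j + ε) in
              (j ≡ i → (inter → x ≡ p C i) × (x ≡ p C i → inter)) ×
              (j ≢ i → (inter → (p C j ≤ᵣ x) × (x ≤ᵣ p C j + ε)) ×
                       ((p C j ≤ᵣ x) × (x ≤ᵣ p C j + ε) → inter))))))))

-- "dim_cb(G) ≤ d" and "dim^ext_cb(G) ≤ d" style predicates.

HasCB : RealField → Graph → ℕ → Set
HasCB R G d = Geom.TouchingCB R G d

HasExtCB : RealField → Graph → ℕ → Set
HasExtCB R G d = Σ (Geom.TouchingCB R G d) (Geom.Extendable R G d)

{-# OPTIONS --safe #-}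

-- All boxes are cubes, so they are automatically comparable.  Every clique C
-- of the part built so far owns a slot: a small cube at p(C) met exactly by
-- the boxes of C, each in a facet of its own direction.  A new vertex v whose
-- earlier neighbours form a clique K with at most k vertices becomes a cube
-- inside the slot of K: it touches the facets of the members of K, and in a
-- direction m used by no member of K it leaves room below for the old slot of
-- K and above for the slots of the cliques containing v.
--
-- A k-tree is built by such additions starting from any of its cliques: in a
-- clique-sum the starting clique lies in one summand; build that summand
-- first, then the other one starting from the glued clique.

module Submission where

open import Defs renaming (sym to adj-sym)
import Data.Bool as Bool
open import Data.Empty using (⊥-elim)
open import Data.Fin using (Fin; zero; suc) renaming (_<_ to _<ᶠ_)
open import Data.Fin.Properties using (_≟_; any?; all?; ¬∀⟶∃¬; pigeonhole; <⇒≢)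
open import Data.Fin.Subset using (Subset; _∈_; _∉_; _⊆_; _∪_; ⁅_⁆; ⊥)
open import Data.Fin.Subset.Properties using (_∈?_; ⊆-antisym; p⊆p∪q; x∈p∪q⁻; x∈p∪q⁺; x∈⁅x⁆; x∈⁅y⁆⇒x≡y; ∉⊥)
open import Data.List using (List; []; _∷_; allFin)
open import Data.List.Membership.Propositional.Properties using (∈-allFin)
open import Data.List.Relation.Unary.All as All using (All; []; _∷_)
open import Data.Nat using (ℕ; suc; _≤_; s≤s)
open import Data.Nat.Properties using (≤-refl)
open import Data.Product using (Σ-syntax; ∃-syntax; _×_; _,_; proj₁; proj₂)
open import Data.Sum using (_⊎_; inj₁; inj₂) renaming (swap to swap⊎; map₂ to map₂⊎)
open import Data.Vec using (tabulate)
open import Data.Vec.Properties using (lookup∘tabulate; []=⇒lookup; lookup⇒[]=; ≡-dec)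
open import Function using (_∘_; id)
open import Relation.Binary.PropositionalEquality using (_≡_; _≢_; refl; sym; trans; cong; cong₂; subst; subst₂; ≢-sym; module ≡-Reasoning)
open import Relation.Nullary using (¬_; Dec; yes; no; does; contradiction)
open import Relation.Nullary.Decidable using (_×-dec_; ¬?; decidable-stable; dec-true)
open import Relation.Unary using (Decidable)

-- Subsets of a finite vertex set.

comprehension : ∀ {n} {P : Fin n → Set} → Decidable P → Subset n
comprehension P? = tabulate (does ∘ P?)

∈-comprehension⁺ : ∀ {n} {P : Fin n → Set} (P? : Decidable P) {u} → P u → u ∈ comprehension P?
∈-comprehension⁺ P? {u} pu =
  lookup⇒[]= u _ (trans (lookup∘tabulate (does ∘ P?) u) (dec-true (P? u) pu))

∈-comprehension⁻ : ∀ {n} {P : Fin n → Set} (P? : Decidable P) {u} → u ∈ comprehension P? → P u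
∈-comprehension⁻ P? {u} u∈ with P? u | trans (sym (lookup∘tabulate (does ∘ P?) u)) ([]=⇒lookup u∈)
... | yes pu | _ = pu

_≟ˢ_ : ∀ {n} (p q : Subset n) → Dec (p ≡ q)
_≟ˢ_ = ≡-dec Bool._≟_

⊈⇒∃ : ∀ {n} {p q : Subset n} → ¬ (p ⊆ q) → ∃[ u ] (u ∈ p × u ∉ q)
⊈⇒∃ {p = p} {q} p⊈q with any? (λ u → (u ∈? p) ×-dec ¬? (u ∈? q))
... | yes found = found
... | no ¬found = contradiction
  (λ {u} u∈p → decidable-stable (u ∈? q) (λ u∉q → ¬found (u , u∈p , u∉q))) p⊈q

≢⇒∃-differ : ∀ {n} {p q : Subset n} → p ≢ q →
  (∃[ u ] (u ∈ p × u ∉ q)) ⊎ (∃[ u ] (u ∈ q × u ∉ p))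
≢⇒∃-differ {p = p} {q} p≢q with any? (λ u → (u ∈? p) ×-dec ¬? (u ∈? q))
... | yes found = inj₁ found
... | no ¬found = inj₂ (⊈⇒∃ λ q⊆p → p≢q (⊆-antisym
  (λ {u} u∈p → decidable-stable (u ∈? q) (λ u∉q → ¬found (u , u∈p , u∉q))) q⊆p))

x∈p∪⁅y⁆⁻ : ∀ {n} {p : Subset n} {x y} → x ∈ p ∪ ⁅ y ⁆ → x ∈ p ⊎ x ≡ y
x∈p∪⁅y⁆⁻ x∈ = map₂⊎ (x∈⁅y⁆⇒x≡y _) (x∈p∪q⁻ _ _ x∈)

y∈p∪⁅y⁆ : ∀ {n} {p : Subset n} {y} → y ∈ p ∪ ⁅ y ⁆
y∈p∪⁅y⁆ {p = p} {y} = x∈p∪q⁺ {p = p} (inj₂ (x∈⁅x⁆ y))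

-- Building a k-tree inside an ambient graph

-- This is `|K| < d` phrased without cardinalities. The pigeonhole principle delivers it in this
-- form, and the search for a free direction consumes it in this form.
HasNoDistinct : ∀ {n} → ℕ → Subset n → Set
HasNoDistinct d K = (g : Fin d → Fin _) → (∀ i → g i ∈ K) → ¬ (∀ i j → g i ≡ g j → i ≡ j)

-- `S` is the part built so far. By `neighbours` and `joined`, `K` is exactly the neighbourhood of
-- `v` within `S`; edges from `v` to vertices not yet built are unconstrained.
record Attachable (d : ℕ) (G : Graph) (S K : Subset (n G)) (v : Fin (n G)) : Set where
  field
    fresh      : v ∉ S
    K⊆S        : K ⊆ S
    clique     : IsClique G K
    neighbours : ∀ {u} → u ∈ S → Adj G v u → u ∈ K
    joined     : ∀ {u} → u ∈ K → Adj G v u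
    small      : HasNoDistinct d K

record Embedding (H G : Graph) : Set where
  field
    f    : Fin (n H) → Fin (n G)
    f-inj : ∀ {x y} → f x ≡ f y → x ≡ y
    adj⁺ : ∀ {x y} → Adj H x y → Adj G (f x) (f y)
    adj⁻ : ∀ {x y} → Adj G (f x) (f y) → Adj H x y

Image : ∀ {m n} → (Fin m → Fin n) → Fin n → Set
Image f u = ∃[ x ] (f x ≡ u)

image? : ∀ {m n} (f : Fin m → Fin n) → Decidable (Image f)
image? f u = any? (λ x → f x ≟ u)

idEmbedding : ∀ {G} → Embedding G G
idEmbedding = record { f = id ; f-inj = id ; adj⁺ = id ; adj⁻ = id }

swapSum : ∀ {k G G₁ G₂} → IsFullCliqueSum k G G₁ G₂ → IsFullCliqueSum k G G₂ G₁
swapSum s = record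
  { C₁ = C₂ ; C₂ = C₁ ; f₁ = f₂ ; f₂ = f₁ ; f₁-inj = f₂-inj ; f₂-inj = f₁-inj
  ; glue = λ i → sym (glue i)
  ; meetOnly = λ x y e → let (i , ex , ey) = meetOnly y x (sym e) in i , ey , ex
  ; cover = swap⊎ ∘ cover ; adj₁ = adj₂ ; adj₂ = adj₁
  ; edges = λ u v → swap⊎ ∘ edges u v
  }
  where open IsFullCliqueSum s

embed₁ : ∀ {k H H₁ H₂ G} → IsFullCliqueSum k H H₁ H₂ → Embedding H G → Embedding H₁ G
embed₁ s e = record
  { f = f ∘ f₁ ; f-inj = f₁-inj _ _ ∘ f-inj
  ; adj⁺ = adj⁺ ∘ proj₁ (adj₁ _ _) ; adj⁻ = proj₂ (adj₁ _ _) ∘ adj⁻ }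
  where
  open IsFullCliqueSum s
  open Embedding e

module _ (k : ℕ) (G : Graph) (P : Subset (n G) → Set) where

  -- These two conditions let `H` be completed on top of `S` as if nothing else had been built: the
  -- part of `H` already present is a clique, and a missing vertex of `H` has no neighbour in `S`
  -- outside `H`.
  record Compatible {H : Graph} (e : Embedding H G) (S : Subset (n G)) : Set where
    open Embedding e
    field
      clique : ∀ {x y} → f x ∈ S → f y ∈ S → x ≢ y → Adj H x y
      cut    : ∀ {x u} → f x ∉ S → u ∈ S → Adj G (f x) u → Image f u

  record Absorbed {H : Graph} (e : Embedding H G) (S : Subset (n G)) : Set where
    open Embedding e
    field
      S⁺    : Subset (n G)
      holds : P S⁺
      S⊆S⁺  : S ⊆ S⁺
      f∈S⁺  : ∀ x → f x ∈ S⁺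
      S⁺⊆   : ∀ {u} → u ∈ S⁺ → u ∈ S ⊎ Image f u

  -- The induction statement for k-trees. It ranges over every starting set `S`, because the second
  -- summand of a clique-sum is built when the first one is already present.
  Absorbs : Graph → Set
  Absorbs H = (e : Embedding H G) (S : Subset (n G)) → P S → Compatible e S → Absorbed e S

  sum-absorbs₁ : ∀ {H H₁ H₂} (s : IsFullCliqueSum k H H₁ H₂) → Absorbs H₁ → Absorbs H₂ →
    (e : Embedding H G) (S : Subset (n G)) → P S → Compatible e S →
    (∀ {x} → Embedding.f e x ∈ S → Image (IsFullCliqueSum.f₁ s) x) → Absorbed e S
  sum-absorbs₁ {H₂ = H₂} s abs₁ abs₂ e S PS c S∩H⊆H₁ = record
    { S⁺ = B.S⁺ ; holds = B.holds ; S⊆S⁺ = B.S⊆S⁺ ∘ A.S⊆S⁺ ; f∈S⁺ = all∈ ; S⁺⊆ = back }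
    where
    open IsFullCliqueSum s
    open Embedding e
    open Compatible c

    first : Absorbed (embed₁ s e) S
    first = abs₁ (embed₁ s e) S PS record
      { clique = λ {x} {y} x∈ y∈ x≢y → proj₂ (adj₁ x y) (clique x∈ y∈ (x≢y ∘ f₁-inj x y))
      ; cut = cut₁ }
      where
      -- A neighbour in `S` lies in `H` by `cut`, and the part of `S` in `H` lies in the first
      -- summand.
      cut₁ : ∀ {x u} → f (f₁ x) ∉ S → u ∈ S → Adj G (f (f₁ x)) u → Image (f ∘ f₁) u
      cut₁ x∉ u∈ a with cut x∉ u∈ a
      ... | y , refl with S∩H⊆H₁ u∈
      ...   | z , refl = z , refl
    module A = Absorbed first

    -- Whatever is present after the first stage and belongs to `H` lies in the first summand, so
    -- `meetOnly` puts a present vertex of the second summand on the glued clique.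
    glued : ∀ {y} → f (f₂ y) ∈ A.S⁺ → ∃[ i ] (y ≡ vert C₂ i)
    glued {y} y∈ with A.S⁺⊆ y∈
    ... | inj₂ (x , e) = let (i , _ , y≡) = meetOnly x y (f-inj e) in i , y≡
    ... | inj₁ y∈S with S∩H⊆H₁ y∈S
    ...   | x , e = let (i , _ , y≡) = meetOnly x y e in i , y≡

    second : Absorbed (embed₁ (swapSum s) e) A.S⁺
    second = abs₂ (embed₁ (swapSum s) e) A.S⁺ A.holds record { clique = clique₂ ; cut = cut₂ }
      where
      clique₂ : ∀ {x y} → f (f₂ x) ∈ A.S⁺ → f (f₂ y) ∈ A.S⁺ → x ≢ y → Adj H₂ x y
      clique₂ x∈ y∈ x≢y with glued x∈ | glued y∈
      ... | i , refl | j , refl = adj C₂ i j (λ { refl → x≢y refl })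

      -- The first summand is already complete, so an edge of `H` at a missing vertex must come from
      -- the second summand.
      cutH : ∀ {x z} → f (f₂ x) ∉ A.S⁺ → Adj G (f (f₂ x)) (f z) → Image (f ∘ f₂) (f z)
      cutH {x} {z} x∉ a with edges (f₂ x) z (adj⁻ a)
      ... | inj₁ (x′ , _ , e , _) = contradiction (subst (λ w → f w ∈ A.S⁺) e (A.f∈S⁺ x′)) x∉
      ... | inj₂ (_ , z′ , _ , e) = z′ , cong f e

      cut₂ : ∀ {x u} → f (f₂ x) ∉ A.S⁺ → u ∈ A.S⁺ → Adj G (f (f₂ x)) u → Image (f ∘ f₂) u
      cut₂ x∉ u∈ a with A.S⁺⊆ u∈
      ... | inj₂ (_ , refl) = cutH x∉ a
      ... | inj₁ u∈S with cut (x∉ ∘ A.S⊆S⁺) u∈S a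
      ...   | _ , refl = cutH x∉ a
    module B = Absorbed second

    all∈ : ∀ x → f x ∈ B.S⁺
    all∈ x with cover x
    ... | inj₁ (y , refl) = B.S⊆S⁺ (A.f∈S⁺ y)
    ... | inj₂ (y , refl) = B.f∈S⁺ y

    back : ∀ {u} → u ∈ B.S⁺ → u ∈ S ⊎ Image f u
    back u∈ with B.S⁺⊆ u∈
    ... | inj₂ (y , e) = inj₂ (f₂ y , e)
    ... | inj₁ u∈A with A.S⁺⊆ u∈A
    ...   | inj₁ u∈S = inj₁ u∈S
    ...   | inj₂ (y , e) = inj₂ (f₁ y , e)

  -- The part of `S` in `H` is a clique, and no edge joins vertices private to different summands.
  -- If one member lies outside the first summand, all members therefore lie in the second; the
  -- summand containing them is built first.
  sum-absorbs : ∀ {H H₁ H₂} → IsFullCliqueSum k H H₁ H₂ → Absorbs H₁ → Absorbs H₂ → Absorbs H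
  sum-absorbs {H} s abs₁ abs₂ e S PS c
    with any? (λ x → (Embedding.f e x ∈? S) ×-dec ¬? (image? (IsFullCliqueSum.f₁ s) x))
  ... | no ¬x = sum-absorbs₁ s abs₁ abs₂ e S PS c
    λ {x} x∈ → decidable-stable (image? _ x) (λ x∉ → ¬x (x , x∈ , x∉))
  ... | yes (x , x∈ , x∉₁) = sum-absorbs₁ (swapSum s) abs₂ abs₁ e S PS c inside₂
    where
    open IsFullCliqueSum s
    open Embedding e

    inside₂ : ∀ {y} → f y ∈ S → Image f₂ y
    inside₂ {y} y∈ with x ≟ y
    ... | yes refl with cover x
    ...   | inj₁ x∈₁ = contradiction x∈₁ x∉₁
    ...   | inj₂ x∈₂ = x∈₂
    inside₂ {y} y∈ | no x≢y with edges x y (Compatible.clique c x∈ y∈ x≢y)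
    ...   | inj₁ (z , _ , e , _) = contradiction (z , e) x∉₁
    ...   | inj₂ (_ , z , _ , e) = z , e

  module _ (addVertex : ∀ {S K v} → Attachable (suc k) G S K v → P S → P (S ∪ ⁅ v ⁆)) where

    complete-absorbs : ∀ {H} → IsCompleteAtMost (suc k) H → Absorbs H
    complete-absorbs {H} (H≤ , complete) e S PS c = record
      { S⁺ = proj₁ all ; holds = proj₁ (proj₂ all)
      ; S⊆S⁺ = proj₁ (proj₂ (proj₂ all))
      ; f∈S⁺ = λ x → All.lookup (proj₁ (proj₂ (proj₂ (proj₂ all)))) (∈-allFin x)
      ; S⁺⊆ = proj₂ (proj₂ (proj₂ (proj₂ all))) }
      where
      open Embedding e

      Reached : List (Fin (n H)) → Set
      Reached ys = Σ[ T ∈ Subset (n G) ] (P T × S ⊆ T × All (λ y → f y ∈ T) ys ×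
                   (∀ {u} → u ∈ T → u ∈ S ⊎ Image f u))

      extend : ∀ y {ys} → Reached ys → Reached (y ∷ ys)
      extend y {ys} (T , PT , S⊆T , ys∈T , T⊆) with f y ∈? T
      ... | yes y∈ = T , PT , S⊆T , y∈ ∷ ys∈T , T⊆
      ... | no y∉ = T ∪ ⁅ f y ⁆ , addVertex attach PT , p⊆p∪q _ ∘ S⊆T ,
                    y∈p∪⁅y⁆ ∷ All.map (p⊆p∪q _) ys∈T , T⁺⊆
        where
        T⁺⊆ : ∀ {u} → u ∈ T ∪ ⁅ f y ⁆ → u ∈ S ⊎ Image f u
        T⁺⊆ u∈ with x∈p∪⁅y⁆⁻ u∈
        ... | inj₁ u∈T = T⊆ u∈T
        ... | inj₂ refl = inj₂ (y , refl)

        -- The present vertices of `H` are the whole neighbourhood of `f y` in `T`: completeness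
        -- makes them all adjacent, and `cut` excludes neighbours elsewhere.
        K? : Decidable (λ u → u ∈ T × Image f u)
        K? u = (u ∈? T) ×-dec image? f u

        K : Subset (n G)
        K = comprehension K?

        member : ∀ {u} → u ∈ K → u ∈ T × Image f u
        member = ∈-comprehension⁻ K?

        -- Together with y, suc k distinct preimages in H would be too many.
        small : HasNoDistinct (suc k) K
        small g g∈ g-inj = no-collision (pigeonhole (s≤s H≤) h)
          where
          pre : ∀ i → Image f (g i)
          pre i = proj₂ (member (g∈ i))

          h : Fin (suc (suc k)) → Fin (n H)
          h zero    = y
          h (suc i) = proj₁ (pre i)

          h-inj : ∀ i j → h i ≡ h j → i ≡ j
          h-inj zero zero _ = refl
          h-inj zero (suc j) e = ⊥-elim (y∉ (subst (_∈ T)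
            (sym (trans (cong f e) (proj₂ (pre j)))) (proj₁ (member (g∈ j)))))
          h-inj (suc i) zero e = sym (h-inj zero (suc i) (sym e))
          h-inj (suc i) (suc j) e = cong suc (g-inj i j
            (trans (sym (proj₂ (pre i))) (trans (cong f e) (proj₂ (pre j)))))

          no-collision : ¬ (∃[ i ] ∃[ j ] (i <ᶠ j × h i ≡ h j))
          no-collision (i , j , i<j , e) = <⇒≢ i<j (h-inj i j e)

        adjacent : ∀ {u v} → Image f u → Image f v → u ≢ v → Adj G u v
        adjacent (x , refl) (z , refl) u≢v = adj⁺ (proj₂ (complete x z) (u≢v ∘ cong f))

        neighbours : ∀ {u} → u ∈ T → Adj G (f y) u → Image f u
        neighbours u∈T a with T⊆ u∈T
        ... | inj₁ u∈S = Compatible.cut c (y∉ ∘ S⊆T) u∈S a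
        ... | inj₂ u∈f = u∈f

        attach : Attachable (suc k) G T K (f y)
        attach = record
          { fresh = y∉
          ; K⊆S = proj₁ ∘ member
          ; clique = λ u v u∈ v∈ → adjacent (proj₂ (member u∈)) (proj₂ (member v∈))
          ; neighbours = λ u∈T a → ∈-comprehension⁺ K? (u∈T , neighbours u∈T a)
          ; joined = λ u∈ → adjacent (y , refl) (proj₂ (member u∈))
              (λ e → y∉ (subst (_∈ T) (sym e) (proj₁ (member u∈))))
          ; small = small }

      reach : ∀ ys → Reached ys
      reach [] = S , PS , id , [] , inj₁
      reach (y ∷ ys) = extend y (reach ys)

      all : Reached (allFin (n H))
      all = reach (allFin (n H))

    kTree-absorbs : ∀ {H} → IsKTree k H → Absorbs H
    kTree-absorbs (base complete) = complete-absorbs complete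
    kTree-absorbs (csum t₁ t₂ s) = sum-absorbs s (kTree-absorbs t₁) (kTree-absorbs t₂)

    kTree-induction : IsKTree k G → P ⊥ → Σ[ S ∈ Subset (n G) ] (P S × (∀ u → u ∈ S))
    kTree-induction t P⊥ = S⁺ , holds , f∈S⁺
      where
      absorbed : Absorbed idEmbedding ⊥
      absorbed = kTree-absorbs t idEmbedding ⊥ P⊥ record
        { clique = λ x∈ → contradiction x∈ ∉⊥ ; cut = λ _ u∈ → contradiction u∈ ∉⊥ }
      open Absorbed absorbed

-- Ordered-field arithmetic

module RealOrder (R : RealField) where
  open RealField R

  ≤ᵣ-refl : ∀ {x} → x ≤ᵣ x
  ≤ᵣ-refl = inj₂ refl

  ≤ᵣ-trans : ∀ {x y z} → x ≤ᵣ y → y ≤ᵣ z → x ≤ᵣ z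
  ≤ᵣ-trans (inj₁ x<y) (inj₁ y<z) = inj₁ (<-trans x<y y<z)
  ≤ᵣ-trans (inj₁ x<y) (inj₂ refl) = inj₁ x<y
  ≤ᵣ-trans (inj₂ refl) y≤z = y≤z

  <-≤ᵣ-trans : ∀ {x y z} → x < y → y ≤ᵣ z → x < z
  <-≤ᵣ-trans x<y (inj₁ y<z) = <-trans x<y y<z
  <-≤ᵣ-trans x<y (inj₂ refl) = x<y

  ≤ᵣ-<-trans : ∀ {x y z} → x ≤ᵣ y → y < z → x < z
  ≤ᵣ-<-trans (inj₁ x<y) y<z = <-trans x<y y<z
  ≤ᵣ-<-trans (inj₂ refl) y<z = y<z

  <⇒≱ᵣ : ∀ {x y} → x < y → ¬ (y ≤ᵣ x)
  <⇒≱ᵣ x<y y≤x = <-irrefl _ (<-≤ᵣ-trans x<y y≤x)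

  +-monoˡ-≤ : ∀ {x y} z → x ≤ᵣ y → x + z ≤ᵣ y + z
  +-monoˡ-≤ z (inj₁ x<y) = inj₁ (+-mono-< z x<y)
  +-monoˡ-≤ z (inj₂ refl) = ≤ᵣ-refl

  +-monoʳ-< : ∀ {x y} z → x < y → z + x < z + y
  +-monoʳ-< z x<y = subst₂ _<_ (+-comm _ z) (+-comm _ z) (+-mono-< z x<y)

  +-monoʳ-≤ : ∀ {x y} z → x ≤ᵣ y → z + x ≤ᵣ z + y
  +-monoʳ-≤ z x≤y = subst₂ _≤ᵣ_ (+-comm _ z) (+-comm _ z) (+-monoˡ-≤ z x≤y)

  +-identityʳ : ∀ x → x + 0ᵣ ≡ x
  +-identityʳ x = trans (+-comm x 0ᵣ) (+-identity x)

  x<x+y : ∀ x {y} → 0ᵣ < y → x < x + y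
  x<x+y x 0<y = subst (_< x + _) (+-identityʳ x) (+-monoʳ-< x 0<y)

  x≤x+y : ∀ x {y} → 0ᵣ ≤ᵣ y → x ≤ᵣ x + y
  x≤x+y x 0≤y = subst (_≤ᵣ x + _) (+-identityʳ x) (+-monoʳ-≤ x 0≤y)

  0<x+y : ∀ {x y} → 0ᵣ < x → 0ᵣ < y → 0ᵣ < x + y
  0<x+y 0<x 0<y = <-trans 0<x (x<x+y _ 0<y)

  x+x≡x⇒x≡0 : ∀ {x} → x + x ≡ x → x ≡ 0ᵣ
  x+x≡x⇒x≡0 {x} e with trichotomy x 0ᵣ
  ... | inj₁ x<0 = ⊥-elim (<-irrefl x (subst₂ _<_ e (+-identity x) (+-mono-< x x<0)))
  ... | inj₂ (inj₁ x≡0) = x≡0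
  ... | inj₂ (inj₂ 0<x) = ⊥-elim (<-irrefl x (subst₂ _<_ (+-identity x) e (+-mono-< x 0<x)))

  *-zeroʳ : ∀ x → x * 0ᵣ ≡ 0ᵣ
  *-zeroʳ x = x+x≡x⇒x≡0 (trans (sym (distrib x 0ᵣ 0ᵣ)) (cong (x *_) (+-identity 0ᵣ)))

  *-identityʳ : ∀ x → x * 1ᵣ ≡ x
  *-identityʳ x = trans (*-comm x 1ᵣ) (*-identity x)

  -- If `1ᵣ < 0ᵣ`, then `m = - 1ᵣ` is positive, so `m * m + m` is positive, yet it equals
  -- `m * (m + 1ᵣ)`, which is zero.
  0<1 : 0ᵣ < 1ᵣ
  0<1 with trichotomy 0ᵣ 1ᵣ
  ... | inj₁ 0<1 = 0<1
  ... | inj₂ (inj₁ 0≡1) = contradiction 0≡1 0≢1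
  ... | inj₂ (inj₂ 1<0) = ⊥-elim (<-irrefl 0ᵣ (subst (0ᵣ <_) sum≡0 (0<x+y (*-pos 0<m 0<m) 0<m)))
    where
    open ≡-Reasoning
    m = - 1ᵣ
    0<m : 0ᵣ < m
    0<m = subst₂ _<_ (+-inverse 1ᵣ) (+-identity m) (+-mono-< m 1<0)
    sum≡0 : m * m + m ≡ 0ᵣ
    sum≡0 = begin
      m * m + m        ≡⟨ cong (m * m +_) (sym (*-identityʳ m)) ⟩
      m * m + m * 1ᵣ   ≡⟨ sym (distrib m m 1ᵣ) ⟩
      m * (m + 1ᵣ)     ≡⟨ cong (m *_) (trans (+-comm m 1ᵣ) (+-inverse 1ᵣ)) ⟩
      m * 0ᵣ           ≡⟨ *-zeroʳ m ⟩
      0ᵣ               ∎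

  halve : ∀ x → 0ᵣ < x → ∃[ y ] ((0ᵣ < y) × (y + y ≡ x))
  halve x 0<x = y , 0<y , y+y≡x
    where
    2≢0 : 1ᵣ + 1ᵣ ≢ 0ᵣ
    2≢0 e = <-irrefl 0ᵣ (subst (0ᵣ <_) e (0<x+y 0<1 0<1))
    h = proj₁ (*-inverse (1ᵣ + 1ᵣ) 2≢0)
    y = x * h
    h+h≡1 : h + h ≡ 1ᵣ
    h+h≡1 = trans (sym (cong₂ _+_ (*-identityʳ h) (*-identityʳ h)))
      (trans (sym (distrib h 1ᵣ 1ᵣ)) (trans (*-comm h _) (proj₂ (*-inverse (1ᵣ + 1ᵣ) 2≢0))))
    y+y≡x : y + y ≡ x
    y+y≡x = trans (sym (distrib x h h)) (trans (cong (x *_) h+h≡1) (*-identityʳ x))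
    0<y : 0ᵣ < y
    0<y with trichotomy 0ᵣ y
    ... | inj₁ 0<y = 0<y
    ... | inj₂ (inj₁ 0≡y) = ⊥-elim (<-irrefl 0ᵣ (subst (0ᵣ <_)
            (trans (sym y+y≡x) (trans (cong₂ _+_ (sym 0≡y) (sym 0≡y)) (+-identity 0ᵣ))) 0<x))
    ... | inj₂ (inj₂ y<0) = ⊥-elim (<-irrefl 0ᵣ (<-trans 0<x
            (subst₂ _<_ y+y≡x (+-identity 0ᵣ) (<-trans (+-mono-< y y<0) (+-monoʳ-< 0ᵣ y<0)))))

-- Cubes

module Cubes (R : RealField) where
  open RealField R
  open RealOrder R
  open Geom R using (Point; Meet; InteriorsDisjoint; Comparable; cube)

  -- Positivity of `size` is kept out of the record: assignments of cubes are total on the vertices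
  -- of `G`, and the cubes of vertices not yet built may be degenerate.
  record Cube (d : ℕ) : Set where
    constructor _,,_
    field
      corner : Point d
      size   : Carrier
  open Cube public

  top : ∀ {d} → Cube d → Point d
  top A j = corner A j + size A

  -- Separation along one coordinate: the strict form excludes common points, the weak form only
  -- common interior points.
  Apart NonOverlapping _⊆ᶜ_ : ∀ {d} → Cube d → Cube d → Set
  Apart A B = ∃[ j ] (top A j < corner B j ⊎ top B j < corner A j)
  NonOverlapping A B = ∃[ j ] (top A j ≤ᵣ corner B j ⊎ top B j ≤ᵣ corner A j)
  A ⊆ᶜ B = ∀ j → (corner B j ≤ᵣ corner A j) × (top A j ≤ᵣ top B j)

  -- Condition (c2): A meets B in the lower facet of B orthogonal to i.
  MeetsFacet : ∀ {d} → Cube d → Fin d → Cube d → Set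
  MeetsFacet A i B = (top A i ≡ corner B i) ×
    (∀ j → j ≢ i → (corner A j ≤ᵣ corner B j) × (top B j ≤ᵣ top A j))

  WithinUnit : ∀ {d} → Cube d → Set
  WithinUnit A = ∀ j → (0ᵣ ≤ᵣ corner A j) × (top A j < 1ᵣ)

  module _ {d : ℕ} where

    Apart-sym : {A B : Cube d} → Apart A B → Apart B A
    Apart-sym (j , s) = j , swap⊎ s

    NonOverlapping-sym : {A B : Cube d} → NonOverlapping A B → NonOverlapping B A
    NonOverlapping-sym (j , s) = j , swap⊎ s

    Apart⇒NonOverlapping : {A B : Cube d} → Apart A B → NonOverlapping A B
    Apart⇒NonOverlapping (j , inj₁ s) = j , inj₁ (inj₁ s)
    Apart⇒NonOverlapping (j , inj₂ s) = j , inj₂ (inj₁ s)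

    Apart-⊆ : {A B B′ : Cube d} → B′ ⊆ᶜ B → Apart A B → Apart A B′
    Apart-⊆ sub (j , inj₁ s) = j , inj₁ (<-≤ᵣ-trans s (proj₁ (sub j)))
    Apart-⊆ sub (j , inj₂ s) = j , inj₂ (≤ᵣ-<-trans (proj₂ (sub j)) s)

    WithinUnit-⊆ : {A B : Cube d} → A ⊆ᶜ B → WithinUnit B → WithinUnit A
    WithinUnit-⊆ sub w j = ≤ᵣ-trans (proj₁ (w j)) (proj₁ (sub j)) , ≤ᵣ-<-trans (proj₂ (sub j)) (proj₂ (w j))

    MeetsFacet-⊆ : {A B B′ : Cube d} {i : Fin d} → B′ ⊆ᶜ B → corner B i ≡ corner B′ i →
                   MeetsFacet A i B → MeetsFacet A i B′
    MeetsFacet-⊆ sub e (facet , others) = trans facet e , λ j j≢i →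
      ≤ᵣ-trans (proj₁ (others j j≢i)) (proj₁ (sub j)) , ≤ᵣ-trans (proj₂ (sub j)) (proj₂ (others j j≢i))

    shrink : (p : Point d) {s t : Carrier} → s ≤ᵣ t → (p ,, s) ⊆ᶜ (p ,, t)
    shrink p s≤t j = ≤ᵣ-refl , +-monoʳ-≤ (p j) s≤t

    offset-⊆ : (p : Point d) (o : Point d) {s t : Carrier} →
      (∀ j → (0ᵣ ≤ᵣ o j) × (o j + s ≤ᵣ t)) → ((λ j → p j + o j) ,, s) ⊆ᶜ (p ,, t)
    offset-⊆ p o {s} {t} bounds j = x≤x+y (p j) (proj₁ (bounds j)) ,
      subst (_≤ᵣ p j + t) (sym (+-assoc (p j) (o j) s)) (+-monoʳ-≤ (p j) (proj₂ (bounds j)))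

    -- Two cubes meeting the same facet of a third one overlap near it.
    facet-injective : {A B Q : Cube d} {i : Fin d} → 0ᵣ < size A → 0ᵣ < size B → 0ᵣ < size Q →
      MeetsFacet A i Q → MeetsFacet B i Q → ¬ NonOverlapping A B
    facet-injective {A} {B} {Q} {i} A>0 B>0 Q>0 (fA , oA) (fB , oB) (j , s) with j ≟ i | s
    ... | yes refl | inj₁ s = <⇒≱ᵣ (x<x+y (corner B i) B>0) (subst (_≤ᵣ corner B i) (trans fA (sym fB)) s)
    ... | yes refl | inj₂ s = <⇒≱ᵣ (x<x+y (corner A i) A>0) (subst (_≤ᵣ corner A i) (trans fB (sym fA)) s)
    ... | no j≢i | inj₁ s = <⇒≱ᵣ (x<x+y (corner Q j) Q>0)
            (≤ᵣ-trans (proj₂ (oA j j≢i)) (≤ᵣ-trans s (proj₁ (oB j j≢i))))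
    ... | no j≢i | inj₂ s = <⇒≱ᵣ (x<x+y (corner Q j) Q>0)
            (≤ᵣ-trans (proj₂ (oB j j≢i)) (≤ᵣ-trans s (proj₁ (oA j j≢i))))

    toBox : (A : Cube d) → 0ᵣ < size A → Geom.Box R d
    toBox A = cube (corner A) (size A)

    Apart⇒¬Meet : {A B : Cube d} (A>0 : 0ᵣ < size A) (B>0 : 0ᵣ < size B) →
      Apart A B → ¬ Meet (toBox A A>0) (toBox B B>0)
    Apart⇒¬Meet _ _ (j , inj₁ s) (x , xA , xB) = <⇒≱ᵣ s (≤ᵣ-trans (proj₁ (xB j)) (proj₂ (xA j)))
    Apart⇒¬Meet _ _ (j , inj₂ s) (x , xA , xB) = <⇒≱ᵣ s (≤ᵣ-trans (proj₁ (xA j)) (proj₂ (xB j)))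

    NonOverlapping⇒disjoint : {A B : Cube d} (A>0 : 0ᵣ < size A) (B>0 : 0ᵣ < size B) →
      NonOverlapping A B → InteriorsDisjoint (toBox A A>0) (toBox B B>0)
    NonOverlapping⇒disjoint _ _ (j , inj₁ s) (x , xA , xB) =
      <⇒≱ᵣ (<-trans (proj₁ (xB j)) (proj₂ (xA j))) s
    NonOverlapping⇒disjoint _ _ (j , inj₂ s) (x , xA , xB) =
      <⇒≱ᵣ (<-trans (proj₁ (xA j)) (proj₂ (xB j))) s

    size-≤⇒⊑ : {A B : Cube d} (A>0 : 0ᵣ < size A) (B>0 : 0ᵣ < size B) →
      size A ≤ᵣ size B → Geom._⊑_ R (toBox A A>0) (toBox B B>0)
    size-≤⇒⊑ {A} {B} _ _ A≤B = (λ j → corner B j + - corner A j) , λ j →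
      inj₂ (sym (move (corner A j) (corner B j))) ,
      subst (_≤ᵣ top B j) (sym (moveTop (corner A j) (size A) (corner B j))) (+-monoʳ-≤ (corner B j) A≤B)
      where
      open ≡-Reasoning
      move : ∀ a b → a + (b + - a) ≡ b
      move a b = begin
        a + (b + - a)  ≡⟨ cong (a +_) (+-comm b (- a)) ⟩
        a + (- a + b)  ≡⟨ sym (+-assoc a (- a) b) ⟩
        (a + - a) + b  ≡⟨ cong (_+ b) (+-inverse a) ⟩
        0ᵣ + b         ≡⟨ +-identity b ⟩
        b              ∎
      moveTop : ∀ a s b → (a + s) + (b + - a) ≡ b + s
      moveTop a s b = begin
        (a + s) + (b + - a)  ≡⟨ cong (_+ (b + - a)) (+-comm a s) ⟩
        (s + a) + (b + - a)  ≡⟨ +-assoc s a _ ⟩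
        s + (a + (b + - a))  ≡⟨ cong (s +_) (move a b) ⟩
        s + b                ≡⟨ +-comm s b ⟩
        b + s                ∎

    cubes-comparable : {A B : Cube d} (A>0 : 0ᵣ < size A) (B>0 : 0ᵣ < size B) →
      Comparable (toBox A A>0) (toBox B B>0)
    cubes-comparable {A} {B} A>0 B>0 with trichotomy (size A) (size B)
    ... | inj₁ A<B = inj₁ (size-≤⇒⊑ A>0 B>0 (inj₁ A<B))
    ... | inj₂ (inj₁ A≡B) = inj₁ (size-≤⇒⊑ A>0 B>0 (inj₂ A≡B))
    ... | inj₂ (inj₂ B<A) = inj₂ (size-≤⇒⊑ B>0 A>0 (inj₁ B<A))

-- Representations of the subgraph induced by S

module Representation (R : RealField) (k : ℕ) (G : Graph) where
  open RealField R
  open RealOrder R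
  open Cubes R
  open Geom R using (Point; TouchingCB; Meet; Extendable; cube; _∈B_)

  d : ℕ
  d = suc k

  CliqueIn : Subset (n G) → Subset (n G) → Set
  CliqueIn S C = C ⊆ S × IsClique G C

  -- Contact of adjacent boxes is not a field: it follows from `slot-meets` for the clique formed by
  -- the two vertices. Values at vertices outside `S`, or at sets that are not cliques in `S`, are
  -- arbitrary.
  record Rep (S : Subset (n G)) : Set where
    field
      box   : Fin (n G) → Cube d
      point : Subset (n G) → Point d
      dir   : Subset (n G) → Fin (n G) → Fin d
      ε     : Carrier
      ε>0   : 0ᵣ < ε

    slot : Subset (n G) → Cube d
    slot C = point C ,, ε

    field
      box>0       : ∀ {u} → u ∈ S → 0ᵣ < size (box u)
      box-within  : ∀ {u} → u ∈ S → WithinUnit (box u)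
      box-pair    : ∀ {u v} → u ∈ S → v ∈ S → u ≢ v →
                    (Adj G u v × NonOverlapping (box u) (box v)) ⊎ Apart (box u) (box v)
      slot-within : ∀ {C} → CliqueIn S C → WithinUnit (slot C)
      slot-apart  : ∀ {C C′} → CliqueIn S C → CliqueIn S C′ → C ≢ C′ → Apart (slot C) (slot C′)
      slot-avoids : ∀ {C u} → CliqueIn S C → u ∈ S → u ∉ C → Apart (box u) (slot C)
      slot-meets  : ∀ {C u} → CliqueIn S C → u ∈ C → MeetsFacet (box u) (dir C u) (slot C)

    box-nonOverlapping : ∀ {u v} → u ∈ S → v ∈ S → u ≢ v → NonOverlapping (box u) (box v)
    box-nonOverlapping u∈ v∈ u≢v with box-pair u∈ v∈ u≢v
    ... | inj₁ (_ , s) = s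
    ... | inj₂ s = Apart⇒NonOverlapping s

    -- Equal directions would place both boxes on one facet of the slot, where they would overlap.
    -- Hence each direction used at a slot has a single owner.
    dir-injective : ∀ {C u v} → CliqueIn S C → u ∈ C → v ∈ C → dir C u ≡ dir C v → u ≡ v
    dir-injective {C} {u} {v} c u∈ v∈ e with u ≟ v
    ... | yes u≡v = u≡v
    ... | no u≢v = ⊥-elim (facet-injective (box>0 (proj₁ c u∈)) (box>0 (proj₁ c v∈)) ε>0
      (slot-meets c u∈) (subst (λ i → MeetsFacet (box v) i (slot C)) (sym e) (slot-meets c v∈))
      (box-nonOverlapping (proj₁ c u∈) (proj₁ c v∈) u≢v))

  -- The empty clique is the only one; its slot is the cube of side one half at the origin, which
  -- stays strictly below 1.
  emptyRep : Rep ⊥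
  emptyRep = record
    { box = λ _ → origin ; point = λ _ _ → 0ᵣ ; dir = λ _ _ → zero
    ; ε = proj₁ half ; ε>0 = proj₁ (proj₂ half)
    ; box>0 = λ u∈ → contradiction u∈ ∉⊥
    ; box-within = λ u∈ → contradiction u∈ ∉⊥
    ; box-pair = λ u∈ → contradiction u∈ ∉⊥
    ; slot-within = λ _ _ → ≤ᵣ-refl , subst₂ _<_ (sym (+-identity _)) (proj₂ (proj₂ half)) (x<x+y _ (proj₁ (proj₂ half)))
    ; slot-apart = λ c c′ C≢C′ → contradiction
        (⊆-antisym (λ u∈ → contradiction (proj₁ c u∈) ∉⊥) (λ u∈ → contradiction (proj₁ c′ u∈) ∉⊥)) C≢C′
    ; slot-avoids = λ _ u∈ → contradiction u∈ ∉⊥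
    ; slot-meets = λ c u∈ → contradiction (proj₁ c u∈) ∉⊥ }
    where
    origin : Cube d
    origin = (λ _ → 0ᵣ) ,, 0ᵣ
    half = halve 1ᵣ 0<1

  -- Attaching one vertex to a representation.

  module AddVertex {S K : Subset (n G)} {v : Fin (n G)} (attach : Attachable d G S K v) (rep : Rep S) where
    open Attachable attach
    open Rep rep

    K-clique : CliqueIn S K
    K-clique = K⊆S , clique

    Used : Fin d → Set
    Used j = ∃[ u ] (u ∈ K × dir K u ≡ j)

    used? : Decidable Used
    used? j = any? (λ u → (u ∈? K) ×-dec (dir K u ≟ j))

    -- If all `d` directions were used, choosing one owner for each would give `d` distinct members
    -- of `K`, against `small`.
    ∃-unused : ∃[ m ] ¬ Used m
    ∃-unused with all? used?
    ... | no ¬all = ¬∀⟶∃¬ d Used used? ¬all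
    ... | yes all = contradiction
      (λ i j e → trans (sym (proj₂ (proj₂ (all i)))) (trans (cong (dir K) e) (proj₂ (proj₂ (all j)))))
      (small (proj₁ ∘ all) (proj₁ ∘ proj₂ ∘ all))

    m : Fin d
    m = proj₁ ∃-unused

    dir≢m : ∀ {u} → u ∈ K → dir K u ≢ m
    dir≢m u∈ e = proj₂ ∃-unused (_ , u∈ , e)

    -- The slot of K has size 8η; the new cube has size 3η and starts at
    -- height 2η in direction m, and the new slots have size η.
    scale : ∃[ η ] ((0ᵣ < η) × (((η + η) + (η + η)) + ((η + η) + (η + η)) ≡ ε))
    scale with halve ε ε>0
    ... | x , 0<x , refl with halve x 0<x
    ...   | y , 0<y , refl with halve y 0<y
    ...     | η , 0<η , refl = η , 0<η , refl

    η a L : Carrier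
    η = proj₁ scale
    a = η + η
    L = a + η

    0<η : 0ᵣ < η
    0<η = proj₁ (proj₂ scale)

    η<a : η < a
    η<a = x<x+y η 0<η

    0<a : 0ᵣ < a
    0<a = <-trans 0<η η<a

    0<L : 0ᵣ < L
    0<L = 0<x+y 0<a 0<η

    a<a+L : a < a + L
    a<a+L = x<x+y a 0<L

    0<a+L : 0ᵣ < a + L
    0<a+L = <-trans 0<a a<a+L

    a+L+η≤ε : (a + L) + η ≤ᵣ ε
    -- The new slots end at height 6η in direction `m`; the bound 6η ≤ 8η is read as `a + (a + a)`
    -- against `(a + a) + (a + a)`.
    a+L+η≤ε = subst₂ _≤ᵣ_ regroup (proj₂ (proj₂ scale)) (+-monoˡ-≤ (a + a) (inj₁ (x<x+y a 0<a)))
      where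
      regroup : a + (a + a) ≡ (a + L) + η
      regroup = trans (cong (a +_) (sym (+-assoc a η η))) (sym (+-assoc a L η))

    a+L≤ε : a + L ≤ᵣ ε
    a+L≤ε = ≤ᵣ-trans (inj₁ (x<x+y _ 0<η)) a+L+η≤ε

    L≤ε : 0ᵣ + L ≤ᵣ ε
    L≤ε = ≤ᵣ-trans (+-monoˡ-≤ L (inj₁ 0<a)) a+L≤ε

    a+η≤ε : a + η ≤ᵣ ε
    a+η≤ε = subst (_≤ᵣ ε) (+-identity L) L≤ε

    η≤a+η : 0ᵣ + η ≤ᵣ a + η
    η≤a+η = +-monoˡ-≤ η (inj₁ 0<a)

    η≤ε : η ≤ᵣ ε
    η≤ε = ≤ᵣ-trans (subst (_≤ᵣ a + η) (+-identity η) η≤a+η) a+η≤ε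

    q : Point d
    q = point K

    -- Relative to `q`, the new cube spans [2η, 5η] in direction `m` and [0, 3η] in the others.
    -- Starting at 0 makes it touch the members of `K`.
    boxOffset : Fin d → Carrier
    boxOffset j with j ≟ m
    ... | yes _ = a
    ... | no _  = 0ᵣ

    boxOffset-m : boxOffset m ≡ a
    boxOffset-m with m ≟ m
    ... | yes _ = refl
    ... | no m≢m = contradiction refl m≢m

    boxOffset-≢m : ∀ {j} → j ≢ m → boxOffset j ≡ 0ᵣ
    boxOffset-≢m {j} j≢m with j ≟ m
    ... | yes j≡m = contradiction j≡m j≢m
    ... | no _ = refl

    newBox : Cube d
    newBox = (λ j → q j + boxOffset j) ,, L

    newBox-⊆ : newBox ⊆ᶜ slot K
    newBox-⊆ = offset-⊆ q boxOffset bounds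
      where
      bounds : ∀ j → (0ᵣ ≤ᵣ boxOffset j) × (boxOffset j + L ≤ᵣ ε)
      bounds j with j ≟ m
      ... | yes _ = inj₁ 0<a , a+L≤ε
      ... | no _  = ≤ᵣ-refl , L≤ε

    UsedBy : Subset (n G) → Fin d → Set
    UsedBy C j = ∃[ u ] (u ∈ C × u ∈ K × dir K u ≡ j)

    usedBy? : ∀ C → Decidable (UsedBy C)
    usedBy? C j = any? (λ u → (u ∈? C) ×-dec ((u ∈? K) ×-dec (dir K u ≟ j)))

    -- In direction `m` the slot starts on top of the new cube. In the direction of a member of `C`
    -- it stays at 0, on the facet met by that member; in all others it moves to 2η, clear of the
    -- members of `K` outside `C`.
    pointOffset : Subset (n G) → Fin d → Carrier
    pointOffset C j with j ≟ m | usedBy? C j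
    ... | yes _ | _     = a + L
    ... | no _  | yes _ = 0ᵣ
    ... | no _  | no _  = a

    pointOffset-m : ∀ C → pointOffset C m ≡ a + L
    pointOffset-m C with m ≟ m | usedBy? C m
    ... | yes _ | _ = refl
    ... | no m≢m | _ = contradiction refl m≢m

    pointOffset-∈ : ∀ {C u} → u ∈ C → u ∈ K → pointOffset C (dir K u) ≡ 0ᵣ
    pointOffset-∈ {C} {u} u∈C u∈K with dir K u ≟ m | usedBy? C (dir K u)
    ... | yes e | _ = contradiction e (dir≢m u∈K)
    ... | no _ | yes _ = refl
    ... | no _ | no unused = contradiction (u , u∈C , u∈K , refl) unused

    pointOffset-∉ : ∀ {C u} → u ∉ C → u ∈ K → pointOffset C (dir K u) ≡ a
    pointOffset-∉ {C} {u} u∉C u∈K with dir K u ≟ m | usedBy? C (dir K u)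
    ... | yes e | _ = contradiction e (dir≢m u∈K)
    ... | no _ | no _ = refl
    ... | no _ | yes (w , w∈C , w∈K , e) =
      contradiction (subst (_∈ C) (dir-injective K-clique w∈K u∈K e) w∈C) u∉C

    newPoint : Subset (n G) → Point d
    newPoint C j = q j + pointOffset C j

    newSlot : Subset (n G) → Cube d
    newSlot C = newPoint C ,, η

    newSlot-⊆ : ∀ C → newSlot C ⊆ᶜ slot K
    newSlot-⊆ C = offset-⊆ q (pointOffset C) bounds
      where
      bounds : ∀ j → (0ᵣ ≤ᵣ pointOffset C j) × (pointOffset C j + η ≤ᵣ ε)
      bounds j with j ≟ m | usedBy? C j
      ... | yes _ | _     = inj₁ 0<a+L , a+L+η≤ε
      ... | no _  | yes _ = ≤ᵣ-refl , ≤ᵣ-trans η≤a+η a+η≤ε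
      ... | no _  | no _  = inj₁ 0<a , a+η≤ε

    oldSlot : Subset (n G) → Cube d
    oldSlot C = point C ,, η

    oldSlot-⊆ : ∀ C → oldSlot C ⊆ᶜ slot C
    oldSlot-⊆ C = shrink (point C) η≤ε

    -- Outside direction `m` the slot occupies [0, η] or [2η, 3η] relative to `q`, and the side 3η
    -- of the new cube covers both.
    newBox-newSlot : ∀ C → MeetsFacet newBox m (newSlot C)
    newBox-newSlot C = facet , others
      where
      facet : top newBox m ≡ newPoint C m
      facet = trans (+-assoc (q m) _ L)
        (cong (q m +_) (trans (cong (_+ L) boxOffset-m) (sym (pointOffset-m C))))
      others : ∀ j → j ≢ m → (corner newBox j ≤ᵣ newPoint C j) × (top (newSlot C) j ≤ᵣ top newBox j)
      others j j≢m with j ≟ m | usedBy? C j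
      ... | yes j≡m | _ = contradiction j≡m j≢m
      ... | no _ | yes _ = ≤ᵣ-refl , +-monoʳ-≤ _ (subst (_≤ᵣ L) (+-identity η) η≤a+η)
      ... | no _ | no _ = +-monoʳ-≤ (q j) (inj₁ 0<a) ,
        inj₂ (trans (+-assoc (q j) a η) (sym (cong (_+ L) (+-identityʳ (q j)))))

    old-newSlot : ∀ {C u} → u ∈ C → u ∈ K → MeetsFacet (box u) (dir K u) (newSlot C)
    old-newSlot {C} {u} u∈C u∈K = MeetsFacet-⊆ (newSlot-⊆ C)
      (sym (trans (cong (q (dir K u) +_) (pointOffset-∈ u∈C u∈K)) (+-identityʳ _)))
      (slot-meets K-clique u∈K)

    -- A box outside `K` avoids the whole slot of `K`. The box of a member of `K` ends at `q` in its
    -- own direction, where the new slot begins 2η later.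
    old-avoids-newSlot : ∀ {C u} → u ∈ S → u ∉ C → Apart (box u) (newSlot C)
    old-avoids-newSlot {C} {u} u∈S u∉C with u ∈? K
    ... | no u∉K = Apart-⊆ (newSlot-⊆ C) (slot-avoids K-clique u∈S u∉K)
    ... | yes u∈K = i , inj₁ (subst₂ _<_ (sym (proj₁ (slot-meets K-clique u∈K)))
            (cong (q i +_) (sym (pointOffset-∉ u∉C u∈K))) (x<x+y (q i) 0<a))
      where i = dir K u

    -- Only the slot of `K` itself needs an argument: shrunk to side η, it ends below the new cube,
    -- which starts at 2η in direction `m`.
    oldSlot-avoids-newBox : ∀ {C} → CliqueIn S C → Apart newBox (oldSlot C)
    oldSlot-avoids-newBox {C} c with C ≟ˢ K
    ... | yes refl = m , inj₂ (+-monoʳ-< (q m) (subst (η <_) (sym boxOffset-m) η<a))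
    ... | no C≢K = Apart-sym {B = newBox} (Apart-⊆ newBox-⊆ (Apart-sym (Apart-⊆ (oldSlot-⊆ C)
            (slot-apart K-clique c (≢-sym C≢K)))))

    oldSlot-newSlot : ∀ {C} C′ → CliqueIn S C → Apart (oldSlot C) (newSlot C′)
    oldSlot-newSlot {C} C′ c with C ≟ˢ K
    ... | yes refl = m , inj₁ (+-monoʳ-< (q m) (subst (η <_) (sym (pointOffset-m C′)) (<-trans η<a a<a+L)))
    ... | no C≢K = Apart-⊆ (newSlot-⊆ C′) (Apart-sym (Apart-⊆ (oldSlot-⊆ C) (slot-apart K-clique c (≢-sym C≢K))))

    -- In the direction of `u` one slot occupies [0, η] and the other starts at 2η.
    newSlot-separated : ∀ {C C′ u} → u ∈ K → u ∈ C → u ∉ C′ → Apart (newSlot C) (newSlot C′)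
    newSlot-separated {C} {C′} {u} u∈K u∈C u∉C′ = i , inj₁ (subst₂ _<_
        (sym (cong (_+ η) (trans (cong (q i +_) (pointOffset-∈ u∈C u∈K)) (+-identityʳ (q i)))))
        (cong (q i +_) (sym (pointOffset-∉ u∉C′ u∈K))) (+-monoʳ-< (q i) η<a))
      where i = dir K u

    -- In the direction of a member `u` of `K`, the box of `u` ends exactly where the new cube
    -- begins; every other old box avoids the slot containing the new cube.
    newBox-old : ∀ {u} → u ∈ S → (Adj G v u × NonOverlapping newBox (box u)) ⊎ Apart newBox (box u)
    newBox-old {u} u∈S with u ∈? K
    ... | yes u∈K = inj₁ (joined u∈K , i , inj₂ (inj₂ (trans (proj₁ (slot-meets K-clique u∈K))
            (sym (trans (cong (q i +_) (boxOffset-≢m (dir≢m u∈K))) (+-identityʳ (q i)))))))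
      where i = dir K u
    ... | no u∉K = inj₂ (Apart-sym (Apart-⊆ newBox-⊆ (slot-avoids K-clique u∈S u∉K)))

    -- The extended representation.

    S⁺ : Subset (n G)
    S⁺ = S ∪ ⁅ v ⁆

    old∈ : ∀ {u} → u ∈ S⁺ → u ≢ v → u ∈ S
    old∈ u∈ u≢v with x∈p∪⁅y⁆⁻ u∈
    ... | inj₁ u∈S = u∈S
    ... | inj₂ u≡v = contradiction u≡v u≢v

    oldClique : ∀ {C} → CliqueIn S⁺ C → v ∉ C → CliqueIn S C
    oldClique {C} (C⊆ , c) v∉C = (λ u∈ → old∈ (C⊆ u∈) (λ u≡v → v∉C (subst (_∈ C) u≡v u∈))) , c

    -- The other members of a clique through `v` are neighbours of `v` in `S`. Such a clique is thus
    -- determined by its part in `K`, which is what the new slots record.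
    newClique : ∀ {C u} → CliqueIn S⁺ C → v ∈ C → u ∈ C → u ≢ v → u ∈ K
    newClique (C⊆ , c) v∈C u∈C u≢v = neighbours (old∈ (C⊆ u∈C) u≢v) (c _ _ v∈C u∈C (≢-sym u≢v))

    choose : {A B : Set} → Dec A → B → B → B
    choose (yes _) x _ = x
    choose (no _)  _ y = y

    box⁺ : Fin (n G) → Cube d
    box⁺ u = choose (u ≟ v) newBox (box u)

    point⁺ : Subset (n G) → Point d
    point⁺ C = choose (v ∈? C) (newPoint C) (point C)

    slot⁺ : Subset (n G) → Cube d
    slot⁺ C = point⁺ C ,, η

    -- For a clique through `v` the slot lies inside the slot of `K`, so an old member keeps the
    -- direction it has there and `v` takes the free one.
    dir⁺ : Subset (n G) → Fin (n G) → Fin d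
    dir⁺ C u = choose (u ≟ v) m (choose (v ∈? C) (dir K u) (dir C u))

    box⁺>0 : ∀ {u} → u ∈ S⁺ → 0ᵣ < size (box⁺ u)
    box⁺>0 {u} u∈ with u ≟ v
    ... | yes _ = 0<L
    ... | no u≢v = box>0 (old∈ u∈ u≢v)

    box⁺-within : ∀ {u} → u ∈ S⁺ → WithinUnit (box⁺ u)
    box⁺-within {u} u∈ with u ≟ v
    ... | yes _ = WithinUnit-⊆ newBox-⊆ (slot-within K-clique)
    ... | no u≢v = box-within (old∈ u∈ u≢v)

    box⁺-pair : ∀ {u w} → u ∈ S⁺ → w ∈ S⁺ → u ≢ w →
      (Adj G u w × NonOverlapping (box⁺ u) (box⁺ w)) ⊎ Apart (box⁺ u) (box⁺ w)
    box⁺-pair {u} {w} u∈ w∈ u≢w with u ≟ v | w ≟ v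
    ... | yes refl | yes refl = contradiction refl u≢w
    ... | yes refl | no w≢v = newBox-old (old∈ w∈ w≢v)
    ... | no u≢v | no w≢v = box-pair (old∈ u∈ u≢v) (old∈ w∈ w≢v) u≢w
    ... | no u≢v | yes refl with newBox-old (old∈ u∈ u≢v)
    ...   | inj₁ (e , s) = inj₁ (adj-sym G e , NonOverlapping-sym s)
    ...   | inj₂ s = inj₂ (Apart-sym s)

    slot⁺-within : ∀ {C} → CliqueIn S⁺ C → WithinUnit (slot⁺ C)
    slot⁺-within {C} c with v ∈? C
    ... | yes _ = WithinUnit-⊆ (newSlot-⊆ C) (slot-within K-clique)
    ... | no v∉C = WithinUnit-⊆ (oldSlot-⊆ C) (slot-within (oldClique c v∉C))

    slot⁺-apart : ∀ {C C′} → CliqueIn S⁺ C → CliqueIn S⁺ C′ → C ≢ C′ → Apart (slot⁺ C) (slot⁺ C′)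
    slot⁺-apart {C} {C′} c c′ C≢C′ with v ∈? C | v ∈? C′
    ... | no v∉C | no v∉C′ = Apart-⊆ (oldSlot-⊆ C′) (Apart-sym (Apart-⊆ (oldSlot-⊆ C)
            (slot-apart (oldClique c′ v∉C′) (oldClique c v∉C) (≢-sym C≢C′))))
    ... | no v∉C | yes _ = oldSlot-newSlot C′ (oldClique c v∉C)
    ... | yes _ | no v∉C′ = Apart-sym (oldSlot-newSlot C (oldClique c′ v∉C′))
    -- Both cliques contain `v`, so a vertex distinguishing them differs from `v` and belongs to
    -- `K`; its direction separates the slots.
    ... | yes v∈C | yes v∈C′ with ≢⇒∃-differ C≢C′
    ...   | inj₁ (u , u∈C , u∉C′) =
            newSlot-separated (newClique c v∈C u∈C (λ { refl → u∉C′ v∈C′ })) u∈C u∉C′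
    ...   | inj₂ (u , u∈C′ , u∉C) =
            Apart-sym (newSlot-separated (newClique c′ v∈C′ u∈C′ (λ { refl → u∉C v∈C })) u∈C′ u∉C)

    slot⁺-avoids : ∀ {C u} → CliqueIn S⁺ C → u ∈ S⁺ → u ∉ C → Apart (box⁺ u) (slot⁺ C)
    slot⁺-avoids {C} {u} c u∈ u∉C with u ≟ v | v ∈? C
    ... | yes refl | yes v∈C = contradiction v∈C u∉C
    ... | yes refl | no v∉C = oldSlot-avoids-newBox (oldClique c v∉C)
    ... | no u≢v | yes _ = old-avoids-newSlot (old∈ u∈ u≢v) u∉C
    ... | no u≢v | no v∉C = Apart-⊆ (oldSlot-⊆ C) (slot-avoids (oldClique c v∉C) (old∈ u∈ u≢v) u∉C)

    slot⁺-meets : ∀ {C u} → CliqueIn S⁺ C → u ∈ C → MeetsFacet (box⁺ u) (dir⁺ C u) (slot⁺ C)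
    slot⁺-meets {C} {u} c u∈C with u ≟ v | v ∈? C
    ... | yes refl | yes _ = newBox-newSlot C
    ... | yes refl | no v∉C = contradiction u∈C v∉C
    ... | no u≢v | yes v∈C = old-newSlot u∈C (newClique c v∈C u∈C u≢v)
    ... | no _ | no v∉C = MeetsFacet-⊆ (oldSlot-⊆ C) refl (slot-meets (oldClique c v∉C) u∈C)

    rep⁺ : Rep S⁺
    rep⁺ = record
      { box = box⁺ ; point = point⁺ ; dir = dir⁺ ; ε = η ; ε>0 = 0<η
      ; box>0 = box⁺>0 ; box-within = box⁺-within ; box-pair = box⁺-pair
      ; slot-within = slot⁺-within ; slot-apart = slot⁺-apart
      ; slot-avoids = slot⁺-avoids ; slot-meets = slot⁺-meets }

  -- From a representation of all vertices to an extendable touching representation.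

  module Complete {S : Subset (n G)} (rep : Rep S) (full : ∀ u → u ∈ S) where
    open Rep rep

    cliqueIn : ∀ {C} → IsClique G C → CliqueIn S C
    cliqueIn c = (λ {u} _ → full u) , c

    h : Fin (n G) → Geom.Box R d
    h u = toBox (box u) (box>0 (full u))

    point∈ : ∀ {C u} → IsClique G C → u ∈ C → point C ∈B h u
    point∈ {C} {u} c u∈ j with slot-meets (cliqueIn c) u∈ | j ≟ dir C u
    ... | facet , _ | yes refl =
          subst (corner (box u) j ≤ᵣ_) facet (inj₁ (x<x+y _ (box>0 (full u)))) , inj₂ (sym facet)
    ... | _ , others | no j≢i =
          proj₁ (others j j≢i) , ≤ᵣ-trans (inj₁ (x<x+y _ ε>0)) (proj₂ (others j j≢i))

    pair-clique : ∀ {u v} → Adj G u v → IsClique G (⁅ u ⁆ ∪ ⁅ v ⁆)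
    pair-clique a x y x∈ y∈ x≢y with x∈p∪⁅y⁆⁻ x∈ | x∈p∪⁅y⁆⁻ y∈
    ... | inj₂ refl | inj₂ refl = contradiction refl x≢y
    ... | inj₂ refl | inj₁ y∈u with refl ← x∈⁅y⁆⇒x≡y _ y∈u = adj-sym G a
    pair-clique a x y x∈ y∈ x≢y | inj₁ x∈u | inj₂ refl with refl ← x∈⁅y⁆⇒x≡y _ x∈u = a
    pair-clique a x y x∈ y∈ x≢y | inj₁ x∈u | inj₁ y∈u =
      contradiction (trans (x∈⁅y⁆⇒x≡y _ x∈u) (sym (x∈⁅y⁆⇒x≡y _ y∈u))) x≢y

    touching : TouchingCB G d
    touching = record
      { h = h
      ; disjoint = λ u v u≢v → NonOverlapping⇒disjoint (box>0 (full u)) (box>0 (full v))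
          (box-nonOverlapping (full u) (full v) u≢v)
      ; touch = λ u v u≢v → meet⇒adj u≢v , adj⇒meet
      ; comp = λ u v → cubes-comparable (box>0 (full u)) (box>0 (full v)) }
      where
      meet⇒adj : ∀ {u v} → u ≢ v → Meet (h u) (h v) → Adj G u v
      meet⇒adj {u} {v} u≢v meet with box-pair (full u) (full v) u≢v
      ... | inj₁ (a , _) = a
      ... | inj₂ s = contradiction meet (Apart⇒¬Meet (box>0 (full u)) (box>0 (full v)) s)
      adj⇒meet : ∀ {u v} → Adj G u v → Meet (h u) (h v)
      -- The corner of the slot owned by the edge is a common point of the two boxes.
      adj⇒meet {u} {v} a = point (⁅ u ⁆ ∪ ⁅ v ⁆) ,
        point∈ (pair-clique a) (p⊆p∪q _ (x∈⁅x⁆ u)) , point∈ (pair-clique a) y∈p∪⁅y⁆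

    -- The threshold is the slot size `ε`. The same points serve every smaller `δ`, since the
    -- `δ`-cube at a point lies in its slot and shares its lower facets.
    extendable : Extendable G d touching
    extendable = (λ u → box-within (full u)) , ε , ε>0 , λ δ δ>0 δ<ε → point ,
      (λ C c → (λ j → proj₁ (slot-within (cliqueIn c) j) ,
                      <-trans (x<x+y _ ε>0) (proj₂ (slot-within (cliqueIn c) j))) ,
               (λ u → point∈ c)) ,
      (λ C C′ c c′ C≢C′ → Apart⇒¬Meet δ>0 δ>0 (Apart-⊆ (small C′ δ<ε) (Apart-sym (Apart-⊆ (small C δ<ε)
          (slot-apart (cliqueIn c′) (cliqueIn c) (≢-sym C≢C′)))))) ,
      (λ C c u → (meet⇒∈ c δ>0 δ<ε , λ u∈ → point C , point∈ c u∈ ,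
                    (λ j → ≤ᵣ-refl , inj₁ (x<x+y _ δ>0))) ,
                 (λ u∈ → dir C u , intersection c δ>0 δ<ε u∈))
      where
      small : ∀ C {δ} → δ < ε → (point C ,, δ) ⊆ᶜ slot C
      small C δ<ε = shrink (point C) (inj₁ δ<ε)

      meet⇒∈ : ∀ {C u δ} → IsClique G C → (δ>0 : 0ᵣ < δ) → δ < ε → Meet (h u) (cube (point C) δ δ>0) → u ∈ C
      meet⇒∈ {C} {u} c δ>0 δ<ε meet with u ∈? C
      ... | yes u∈ = u∈
      ... | no u∉ = contradiction meet
            (Apart⇒¬Meet (box>0 (full u)) δ>0 (Apart-⊆ (small C δ<ε) (slot-avoids (cliqueIn c) (full u) u∉)))

      intersection : ∀ {C u δ} → IsClique G C → 0ᵣ < δ → δ < ε → u ∈ C → ∀ j x →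
        let i = dir C u
            inter = (corner (box u) j ≤ᵣ x) × (x ≤ᵣ top (box u) j) ×
                    (point C j ≤ᵣ x) × (x ≤ᵣ point C j + δ) in
        (j ≡ i → (inter → x ≡ point C i) × (x ≡ point C i → inter)) ×
        (j ≢ i → (inter → (point C j ≤ᵣ x) × (x ≤ᵣ point C j + δ)) ×
                 ((point C j ≤ᵣ x) × (x ≤ᵣ point C j + δ) → inter))
      intersection {C} {u} {δ} c δ>0 δ<ε u∈ j x = at , off
        where
        facet = proj₁ (slot-meets (cliqueIn c) u∈)
        others = proj₂ (slot-meets (cliqueIn c) u∈)

        antisym : ∀ {y z} → y ≤ᵣ z → z ≤ᵣ y → y ≡ z
        antisym (inj₂ e) _ = e
        antisym (inj₁ y<z) z≤y = contradiction z≤y (<⇒≱ᵣ y<z)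

        at : j ≡ dir C u → _
        at refl = (λ { (_ , x≤ , ≤x , _) → antisym (subst (x ≤ᵣ_) facet x≤) ≤x }) ,
          λ { refl → proj₁ (point∈ c u∈ j) , proj₂ (point∈ c u∈ j) , ≤ᵣ-refl , inj₁ (x<x+y _ δ>0) }

        off : j ≢ dir C u → _
        off j≢i = (λ { (_ , _ , ≤x , x≤) → ≤x , x≤ }) ,
          λ { (≤x , x≤) → ≤ᵣ-trans (proj₁ (others j j≢i)) ≤x ,
              ≤ᵣ-trans x≤ (≤ᵣ-trans (proj₂ (small C δ<ε j)) (proj₂ (others j j≢i))) , ≤x , x≤ }

theorem17 : (R : RealField) (k : ℕ) (G : Graph) → IsKTree k G →
    ((d : ℕ) → HasExtCB R G d → Σ[ d′ ∈ ℕ ] ((d′ ≤ d) × HasCB R G d′)) ×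
    (Σ[ d ∈ ℕ ] ((d ≤ suc k) × HasExtCB R G d))
-- The first inequality holds in the same dimension, as an extendable representation is in
-- particular a touching one.
theorem17 R k G t = (λ d (T , _) → d , ≤-refl , T) , d , ≤-refl , touching , extendable
  where
  open Representation R k G
  built = kTree-induction k G Rep AddVertex.rep⁺ t emptyRep
  open Complete (proj₁ (proj₂ built)) (proj₂ (proj₂ built))
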